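{- Let $G$ be a connected graph of order $n$. For any vertex $x$ of $G$ with eccentricity $\mathrm{e}(x)$ we have $p_x(G) \leq n - \mathrm{e}(x)$. Thus $\mathrm{vp}(G) \leq n - \mathrm{rad}(G)$ and $\mathrm{vp}^-(G) \leq n - \mathrm{diam}(G)$.
   Context: All graphs are finite, undirected and simple. A $u,v$-geodesic is a shortest $u,v$-path. The eccentricity of $x$ is $\mathrm{e}(x) = \max_{v \in V(G)} d(x,v)$; $\mathrm{diam}(G)$ and $\mathrm{rad}(G)$ are the maximum and minimum eccentricity over all vertices. For a vertex $x$ of $G$, a set $S \subseteq V(G)$ is an $x$-position set if for every $y \in S$ no vertex of $S \setminus \{y\}$ lies on any $x,y$-geodesic in $G$. The $x$-position number $p_x(G)$ is the maximum cardinality of an $x$-position set of $G$. Define $\mathrm{vp}(G) = \max_{x \in V(G)} p_x(G)$ and $\mathrm{vp}^-(G) = \min_{x \in V(G)} p_x(G)$. -}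

module Defs where

open import Data.Empty using (⊥-elim)
open import Data.Fin using (Fin; zero; suc; _≟_)
open import Data.Fin.Properties using (any?; all?)
open import Data.Fin.Subset using (Subset; _∈_; _-_; ∣_∣; ⊥)
open import Data.Fin.Subset.Properties using (_∈?_; ∉⊥; ∣p∣≤n; anySubset?)
open import Data.List using (tabulate)
open import Data.List.Extrema.Nat using (max; min)
open import Data.Nat using (ℕ; zero; suc; _≤_; z≤n; s≤s; NonZero)
import Data.Nat as ℕ
open import Data.Nat.Properties using (≤-antisym; ≤∧≢⇒<; ≤-pred; n≤0⇒n≡0)
open import Data.Product using (Σ; ∃; _×_; _,_; proj₁; proj₂)
open import Data.Vec using (Vec; []; _∷_; head; last)
open import Data.Vec.Membership.DecPropositional using () renaming (_∈?_ to member?)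
open import Data.Vec.Membership.Propositional using () renaming (_∈_ to _∈ᵥ_; _∉_ to _∉ᵥ_)
open import Data.Vec.Relation.Unary.AllPairs using (allPairs?)
open import Data.Vec.Relation.Unary.Linked using (Linked; linked?)
open import Data.Vec.Relation.Unary.Unique.Propositional using (Unique)
open import Level using (0ℓ)
open import Relation.Binary using (Rel; Symmetric; Irreflexive)
import Relation.Binary as B
open import Relation.Binary.PropositionalEquality using (_≡_; refl; subst)
open import Relation.Nullary using (¬_; Dec; yes; no; ¬?)
open import Relation.Nullary.Decidable using (map′; _×-dec_; _→-dec_)
open import Relation.Unary using (Pred; Decidable)

IsLeast : Pred ℕ 0ℓ → Pred ℕ 0ℓ
IsLeast P m = P m × (∀ {k} → P k → m ≤ k)

IsGreatest : Pred ℕ 0ℓ → Pred ℕ 0ℓ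
IsGreatest P m = P m × (∀ {k} → P k → k ≤ m)

least : {P : Pred ℕ 0ℓ} → Decidable P → ∀ m → P m → ∃ (IsLeast P)
least {P} P? zero    p = zero , p , λ _ → z≤n
least {P} P? (suc m) p with P? zero
... | yes p₀ = zero , p₀ , λ _ → z≤n
... | no ¬p₀ with least (λ k → P? (suc k)) m p
...   | l , pl , l≤ = suc l , pl , λ {k} → bound k
  where
  bound : ∀ k → P k → suc l ≤ k
  bound zero    p₀ = ⊥-elim (¬p₀ p₀)
  bound (suc k) pk = s≤s (l≤ pk)

greatest : {P : Pred ℕ 0ℓ} → Decidable P → ∃ P →
           (b : ℕ) → (∀ {k} → P k → k ≤ b) → ∃ (IsGreatest P)
greatest {P} P? (k , pk) zero ≤b =
  zero , subst P (n≤0⇒n≡0 (≤b pk)) pk , ≤b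
greatest {P} P? w (suc b) ≤b with P? (suc b)
... | yes p = suc b , p , ≤b
... | no ¬p = greatest P? w b λ pk →
        ≤-pred (≤∧≢⇒< (≤b pk) λ k≡ → ¬p (subst P k≡ pk))

-- The base value of `max`/`min` is itself a value of f, so these are exactly
-- the extrema of the image of f.

maximum : ∀ {n} .{{_ : NonZero n}} → (Fin n → ℕ) → ℕ
maximum {suc n} f = max (f zero) (tabulate f)

minimum : ∀ {n} .{{_ : NonZero n}} → (Fin n → ℕ) → ℕ
minimum {suc n} f = min (f zero) (tabulate f)

anyVec? : ∀ {n k} {P : Pred (Vec (Fin n) k) 0ℓ} → Decidable P → Dec (∃ P)
anyVec? {k = zero} P? = map′ ([] ,_) (λ { ([] , p) → p }) (P? [])
anyVec? {k = suc k} P? =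
  map′ (λ (v , vs , p) → v ∷ vs , p) (λ { (v ∷ vs , p) → v , vs , p })
       (any? λ v → anyVec? λ vs → P? (v ∷ vs))

-- Decidability of adjacency is automatic classically; it is what makes the
-- invariants below computable.

record Graph (n : ℕ) : Set₁ where
  field
    _~_    : Rel (Fin n) 0ℓ
    ~-sym  : Symmetric _~_
    ~-irr  : Irreflexive _≡_ _~_
    _~?_   : B.Decidable _~_

module _ {n} (G : Graph n) where

  open Graph G

  -- A path with k edges is given by its sequence of k + 1 distinct vertices.

  record IsPath (u v : Fin n) {k : ℕ} (p : Vec (Fin n) (suc k)) : Set where
    field
      start    : head p ≡ u
      end      : last p ≡ v
      edges    : Linked _~_ p
      distinct : Unique p

  IsGeodesic : (u v : Fin n) {k : ℕ} → Vec (Fin n) (suc k) → Set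
  IsGeodesic u v {k} p =
    IsPath u v p × (∀ {l} (q : Vec (Fin n) (suc l)) → IsPath u v q → k ≤ l)

  HasPath : (u v : Fin n) → ℕ → Set
  HasPath u v k = Σ (Vec (Fin n) (suc k)) λ p → IsPath u v p

  Connected : Set
  Connected = ∀ u v → ∃ (HasPath u v)

  IsPositionSet : Fin n → Subset n → Set
  IsPositionSet x S =
    ∀ {y} → y ∈ S → ∀ {z} → z ∈ S - y →
    ∀ {k} (p : Vec (Fin n) (suc k)) → IsGeodesic x y p → z ∉ᵥ p

  isPath? : ∀ u v {k} → Decidable (IsPath u v {k})
  isPath? u v p =
    map′ (λ (s , e , l , d) → record { start = s ; end = e ; edges = l ; distinct = d })
         (λ π → let open IsPath π in start , end , edges , distinct)
         (head p ≟ u ×-dec last p ≟ v ×-dec linked? _~?_ p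
            ×-dec allPairs? (λ a b → ¬? (a ≟ b)) p)

  hasPath? : ∀ u v → Decidable (HasPath u v)
  hasPath? u v k = anyVec? (isPath? u v)

module _ {n} (G : Graph n) (conn : Connected G) where

  shortest : ∀ u v → ∃ (IsLeast (HasPath G u v))
  shortest u v = least (hasPath? G u v) (proj₁ (conn u v)) (proj₂ (conn u v))

  dist : Fin n → Fin n → ℕ
  dist u v = proj₁ (shortest u v)

  private
    -- Geodesics from x to y are the paths of length dist x y, so only finitely
    -- many vertex sequences need checking to decide IsPositionSet.
    AvoidsPaths : Fin n → Subset n → Set
    AvoidsPaths x S =
      ∀ y → y ∈ S → ∀ z → z ∈ S - y →
      ¬ ∃ λ (p : Vec (Fin n) (suc (dist x y))) → IsPath G x y p × z ∈ᵥ p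

    avoidsPaths? : ∀ x → Decidable (AvoidsPaths x)
    avoidsPaths? x S =
      all? λ y → (y ∈? S) →-dec all? λ z → (z ∈? (S - y)) →-dec
      ¬? (anyVec? λ p → isPath? G x y p ×-dec member? _≟_ z p)

    to : ∀ {x S} → AvoidsPaths x S → IsPositionSet G x S
    to {x} av {y} y∈S {z} z∈S-y {k} p (π , k≤) z∈p =
      av y y∈S z z∈S-y (subst Through k≡d (p , π , z∈p))
      where
      Through : ℕ → Set
      Through k = ∃ λ (p : Vec (Fin n) (suc k)) → IsPath G x y p × z ∈ᵥ p

      k≡d : k ≡ dist x y
      k≡d with shortest x y
      ... | d , (q , ρ) , d≤ = ≤-antisym (k≤ q ρ) (d≤ (p , π))

    from : ∀ {x S} → IsPositionSet G x S → AvoidsPaths x S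
    from {x} pos y y∈S z z∈S-y (p , π , z∈p) =
      pos y∈S z∈S-y p (π , λ q ρ → proj₂ (proj₂ (shortest x y)) (q , ρ)) z∈p

  isPositionSet? : ∀ x → Decidable (IsPositionSet G x)
  isPositionSet? x S = map′ to from (avoidsPaths? x S)

  largestPositionSet : ∀ x → ∃ (IsGreatest λ k → ∃ λ S → IsPositionSet G x S × ∣ S ∣ ≡ k)
  largestPositionSet x =
    greatest (λ k → anySubset? λ S → isPositionSet? x S ×-dec ∣ S ∣ ℕ.≟ k)
             (_ , ⊥ , (λ y∈⊥ → ⊥-elim (∉⊥ y∈⊥)) , refl)
             n (λ { (S , _ , refl) → ∣p∣≤n S })

  positionNumber : Fin n → ℕ
  positionNumber x = proj₁ (largestPositionSet x)

module _ {n} .{{_ : NonZero n}} (G : Graph n) (conn : Connected G) where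

  ecc : Fin n → ℕ
  ecc x = maximum (dist G conn x)

  diam rad : ℕ
  diam = maximum ecc
  rad  = minimum ecc

  vp vp⁻ : ℕ
  vp  = maximum (positionNumber G conn)
  vp⁻ = minimum (positionNumber G conn)

{-# OPTIONS --safe #-}
-- If S is an x-position set and P is a geodesic from x, then P has at most one
-- vertex in S: of two such vertices, the earlier one would lie on the initial
-- segment of P ending at the later one, and that segment is again a geodesic
-- from x.  Hence a geodesic of length e(x) has at least e(x) vertices outside S.
module Submission where

open import Defs
open import Data.Fin using (Fin; zero; suc; _≟_)
open import Data.Fin.Subset using (Subset; _∈_; _-_; ∣_∣; ∁)
open import Data.Fin.Subset.Properties
  using (_∈?_; x∈p⇒∣p-x∣<∣p∣; x∈p∧x≢y⇒x∈p-y; x∉p⇒x∈∁p; ∣∁p∣≡n∸∣p∣; ∣p∣≤n)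
open import Data.List.Extrema.Nat using (max≤v⁺; min≤xs)
open import Data.List.Relation.Unary.All.Properties using (tabulate⁺; tabulate⁻)
open import Data.Nat using (ℕ; zero; suc; NonZero; _≤_; _∸_; _+_; z≤n; s≤s)
open import Data.Nat.Properties
  using (≤-refl; ≤-trans; ≤-reflexive; m≤n⇒m≤1+n; m≤n+m; ∸-monoʳ-≤; m∸[m∸n]≡n;
         +-cancelʳ-≤; module ≤-Reasoning)
open import Data.Product using (∃; _×_; _,_; proj₂)
open import Data.Sum as Sum using (_⊎_; inj₁; inj₂)
open import Data.Vec using (Vec; []; _∷_; head)
open import Data.Vec.Membership.Propositional using () renaming (_∈_ to _∈ᵥ_)
open import Data.Vec.Relation.Unary.All as All using (All; []; _∷_)
open import Data.Vec.Relation.Unary.AllPairs using ([]; _∷_)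
open import Data.Vec.Relation.Unary.Any using (here; there)
open import Data.Vec.Relation.Unary.Linked using ([-]; _∷_)
open import Data.Vec.Relation.Unary.Unique.Propositional using (Unique)
open import Relation.Binary.PropositionalEquality
  using (_≡_; _≢_; refl; sym; cong; subst; ≢-sym)
open import Relation.Nullary using (yes; no; contradiction)
open import Relation.Nullary.Decidable using (toSum)

private
  variable
    A : Set
    n i j k : ℕ

-- Turns upper bounds on eccentricities into upper bounds on position numbers. Subtraction is
-- truncated, so `o ≤ n` is what lets `n ∸ (n ∸ o)` give back `o`.
m≤n∸o⇒o≤n∸m : ∀ {m n o} → o ≤ n → m ≤ n ∸ o → o ≤ n ∸ m
m≤n∸o⇒o≤n∸m {m} {n} {o} o≤n m≤n∸o = begin
  o            ≡⟨ m∸[m∸n]≡n o≤n ⟨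
  n ∸ (n ∸ o)  ≤⟨ ∸-monoʳ-≤ n m≤n∸o ⟩
  n ∸ m        ∎
  where open ≤-Reasoning

maximum≤ : .{{_ : NonZero n}} (f : Fin n → ℕ) {b : ℕ} → (∀ i → f i ≤ b) → maximum f ≤ b
maximum≤ {suc n} f f≤b = max≤v⁺ (f≤b zero) (tabulate⁺ f≤b)

minimum≤ : .{{_ : NonZero n}} (f : Fin n → ℕ) (i : Fin n) → minimum f ≤ f i
minimum≤ {suc n} f = tabulate⁻ (min≤xs (f zero) _)

minimum≤⁺ : .{{_ : NonZero n}} (f : Fin n → ℕ) {b : ℕ} → (∀ i → f i ≤ b) → minimum f ≤ b
minimum≤⁺ {suc n} f f≤b = ≤-trans (minimum≤ f zero) (f≤b zero)

-- The vertex y belongs to both parts: it ends the first and starts the second.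
data SplitAt {A : Set} (y : A) :
     Vec A (suc i) → Vec A (suc j) → Vec A (suc k) → Set where
  here  : {xs : Vec A j} → SplitAt y (y ∷ []) (y ∷ xs) (y ∷ xs)
  there : ∀ {x} {ps : Vec A (suc i)} {ss : Vec A (suc j)} {xs : Vec A (suc k)} →
          SplitAt y ps ss xs → SplitAt y (x ∷ ps) ss (x ∷ xs)

∈⇒SplitAt : {y : A} {xs : Vec A (suc k)} → y ∈ᵥ xs →
            ∃ λ i → ∃ λ j → ∃ λ (ps : Vec A (suc i)) → ∃ λ (ss : Vec A (suc j)) →
            SplitAt y ps ss xs
∈⇒SplitAt (here refl) = _ , _ , _ , _ , here
∈⇒SplitAt {xs = _ ∷ _ ∷ _} (there y∈xs) =
  let _ , _ , _ , _ , s = ∈⇒SplitAt y∈xs in _ , _ , _ , _ , there s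

SplitAt-length : ∀ {y} {ps : Vec A (suc i)} {ss : Vec A (suc j)} {xs : Vec A (suc k)} →
                 SplitAt y ps ss xs → i + j ≡ k
SplitAt-length here      = refl
SplitAt-length (there s) = cong suc (SplitAt-length s)

SplitAt-head : ∀ {y} {ps : Vec A (suc i)} {ss : Vec A (suc j)} {xs : Vec A (suc k)} →
               SplitAt y ps ss xs → head ps ≡ head xs
SplitAt-head here      = refl
SplitAt-head (there s) = refl

SplitAt-All : ∀ {y} {ps : Vec A (suc i)} {ss : Vec A (suc j)} {xs : Vec A (suc k)}
              {P : A → Set} → SplitAt y ps ss xs → All P xs → All P ps
SplitAt-All here      (px ∷ _)   = px ∷ []
SplitAt-All (there s) (px ∷ pxs) = px ∷ SplitAt-All s pxs

-- Order of occurrence, witnessed by the initial segment ending at `z` and not by indices: on a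
-- geodesic this segment is the path to which the position-set condition is applied. The relation is
-- reflexive on the entries of `xs`.
Precedes : Vec A (suc k) → A → A → Set
Precedes {A} xs y z =
  ∃ λ i → ∃ λ j → ∃ λ (ps : Vec A (suc i)) → ∃ λ (ss : Vec A (suc j)) →
  SplitAt z ps ss xs × y ∈ᵥ ps

head-Precedes : ∀ {x z} {xs : Vec A k} → z ∈ᵥ x ∷ xs → Precedes (x ∷ xs) x z
head-Precedes z∈ with ∈⇒SplitAt z∈
... | _ , _ , _ ∷ _ , _ , s = _ , _ , _ , _ , s , here (sym (SplitAt-head s))

Precedes-∷ : ∀ {x y z} {xs : Vec A (suc k)} → Precedes xs y z → Precedes (x ∷ xs) y z
Precedes-∷ (_ , _ , _ , _ , s , y∈) = _ , _ , _ , _ , there s , there y∈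

Precedes-total : ∀ {y z} {xs : Vec A (suc k)} → y ∈ᵥ xs → z ∈ᵥ xs →
                 Precedes xs y z ⊎ Precedes xs z y
Precedes-total (here refl) z∈          = inj₁ (head-Precedes z∈)
Precedes-total y∈@(there _) (here refl) = inj₂ (head-Precedes y∈)
Precedes-total {xs = _ ∷ _ ∷ _} (there y∈) (there z∈) =
  Sum.map Precedes-∷ Precedes-∷ (Precedes-total y∈ z∈)

Unique⇒length≤∣∣ : (U : Subset n) {p : Vec (Fin n) k} → Unique p →
                   (∀ {a} → a ∈ᵥ p → a ∈ U) → k ≤ ∣ U ∣
Unique⇒length≤∣∣ U []         p⊆U = z≤n
Unique⇒length≤∣∣ U (a≢p ∷ p!) p⊆U =
  ≤-trans (s≤s (Unique⇒length≤∣∣ (U - _) p! λ b∈p →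
             x∈p∧x≢y⇒x∈p-y (p⊆U (there b∈p)) (≢-sym (All.lookup a≢p b∈p))))
          (x∈p⇒∣p-x∣<∣p∣ (p⊆U (here refl)))

-- At most one of the `suc k` entries lies outside `U`, and that one is not counted. Entries in `U`
-- are removed from it one by one until the exception, if any, is met.
allButOne⇒length≤∣∣ : (U : Subset n) {p : Vec (Fin n) (suc k)} → Unique p →
                      (∀ {a b} → a ∈ᵥ p → b ∈ᵥ p → a ≢ b → a ∈ U ⊎ b ∈ U) → k ≤ ∣ U ∣
allButOne⇒length≤∣∣ U {_ ∷ []} _ _ = z≤n
allButOne⇒length≤∣∣ U {a ∷ p@(_ ∷ _)} (a≢p ∷ p!) one with a ∈? U
... | yes a∈U =
  ≤-trans (s≤s (allButOne⇒length≤∣∣ (U - a) p! λ b∈p c∈p b≢c →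
             Sum.map (remove b∈p) (remove c∈p) (one (there b∈p) (there c∈p) b≢c)))
          (x∈p⇒∣p-x∣<∣p∣ a∈U)
  where
  remove : ∀ {b} → b ∈ᵥ p → b ∈ U → b ∈ U - a
  remove b∈p b∈U = x∈p∧x≢y⇒x∈p-y b∈U (≢-sym (All.lookup a≢p b∈p))
-- Here `a` is the exception: paired with it, every later entry must lie in `U`.
... | no a∉U = Unique⇒length≤∣∣ U p! λ b∈p →
  Sum.[ (λ a∈U → contradiction a∈U a∉U) , (λ b∈U → b∈U) ]
    (one (here refl) (there b∈p) (All.lookup a≢p b∈p))

module _ (G : Graph n) where

  open Graph G

  IsPath-tail : ∀ {u v a} {p : Vec (Fin n) (suc k)} →
                IsPath G u v (a ∷ p) → IsPath G (head p) v p
  IsPath-tail record { end = end ; edges = _ ∷ edges ; distinct = _ ∷ distinct } =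
    record { start = refl ; end = end ; edges = edges ; distinct = distinct }

  SplitAt-IsPath : ∀ {u v y} {q : Vec (Fin n) (suc i)} {r : Vec (Fin n) (suc j)}
                   {p : Vec (Fin n) (suc k)} → SplitAt y q r p →
                   IsPath G u v p → IsPath G u y q × IsPath G y v r
  SplitAt-IsPath here π =
    record { start = start ; end = refl ; edges = [-] ; distinct = [] ∷ [] } ,
    record { start = refl ; end = end ; edges = edges ; distinct = distinct }
    where open IsPath π
  SplitAt-IsPath (there s) π@record { start = start ; edges = a~p ∷ _ ; distinct = a≢p ∷ _ }
    with ρ , σ ← SplitAt-IsPath s (IsPath-tail π) =
    record { start = start ; end = ρ.end
           ; edges = subst (_ ~_) (sym ρ.start) a~p ∷ ρ.edges
           ; distinct = SplitAt-All s a≢p ∷ ρ.distinct } , σ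
    where module ρ = IsPath ρ

  -- Putting `u` in front of the path may repeat a vertex. If `u` already occurs, the part of the
  -- path from that occurrence on is a path from `u` and is no longer than the original, hence only
  -- an upper bound on `l`.
  extend : ∀ {u w v} → u ~ w → HasPath G w v k → ∃ λ l → l ≤ suc k × HasPath G u v l
  extend {u = u} u~w (p , π) with All.decide (λ a → Sum.swap (toSum (u ≟ a))) p
  ... | inj₁ u≢p = _ , ≤-refl , u ∷ p , record
    { start = refl ; end = end ; edges = subst (u ~_) (sym start) u~w ∷ edges
    ; distinct = u≢p ∷ distinct }
    where open IsPath π
  ... | inj₂ u∈p with i , j , _ , r , s ← ∈⇒SplitAt u∈p =
    j , m≤n⇒m≤1+n (subst (j ≤_) (SplitAt-length s) (m≤n+m j i)) , r , proj₂ (SplitAt-IsPath s π)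

  -- A triangle inequality. Two concatenated paths may share vertices, so the vertices of `q` are
  -- put in front one at a time by `extend`, which cuts out any cycle that arises.
  join : ∀ {u y v} (q : Vec (Fin n) (suc i)) → IsPath G u y q → HasPath G y v j →
         ∃ λ l → l ≤ i + j × HasPath G u v l
  join (_ ∷ []) record { start = refl ; end = refl } ρ = _ , ≤-refl , ρ
  join (_ ∷ q@(_ ∷ _)) π@record { start = refl ; edges = u~w ∷ _ } ρ
    with _ , l≤ , σ ← join q (IsPath-tail π) ρ
    with _ , m≤ , τ ← extend u~w σ = _ , ≤-trans m≤ (s≤s l≤) , τ

  -- A shorter path from `u` to `y`, joined with the remaining part `r`, would give a path from `u`
  -- to `v` shorter than `p`.
  SplitAt-IsGeodesic : ∀ {u v y} {q : Vec (Fin n) (suc i)} {r : Vec (Fin n) (suc j)}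
                       {p : Vec (Fin n) (suc k)} → SplitAt y q r p →
                       IsGeodesic G u v p → IsGeodesic G u y q
  SplitAt-IsGeodesic {i = i} {j = j} {k = k} {u = u} {y = y} {r = r} s (π , k≤)
    with ρ , σ ← SplitAt-IsPath s π = ρ , i≤
    where
    i≤ : ∀ {l} (q′ : Vec (Fin n) (suc l)) → IsPath G u y q′ → i ≤ l
    i≤ {l} q′ ρ′ with m , m≤l+j , t , τ ← join q′ ρ′ (r , σ) = +-cancelʳ-≤ j i l (begin
      i + j  ≡⟨ SplitAt-length s ⟩
      k      ≤⟨ k≤ t τ ⟩
      m      ≤⟨ m≤l+j ⟩
      l + j  ∎)
      where open ≤-Reasoning

  geodesic-avoids : ∀ {x v} {S : Subset n} {p : Vec (Fin n) (suc k)} → IsPositionSet G x S →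
                    IsGeodesic G x v p → ∀ {y z} → y ∈ᵥ p → z ∈ᵥ p → y ≢ z →
                    y ∈ ∁ S ⊎ z ∈ ∁ S
  geodesic-avoids {S = S} pos γ {y} {z} y∈p z∈p y≢z with y ∈? S | z ∈? S
  ... | no y∉S  | _       = inj₁ (x∉p⇒x∈∁p y∉S)
  ... | yes _   | no z∉S  = inj₂ (x∉p⇒x∈∁p z∉S)
  ... | yes y∈S | yes z∈S with Precedes-total y∈p z∈p
  ... | inj₁ (_ , _ , q , _ , s , y∈q) =
    contradiction y∈q (pos z∈S (x∈p∧x≢y⇒x∈p-y y∈S y≢z) q (SplitAt-IsGeodesic s γ))
  ... | inj₂ (_ , _ , q , _ , s , z∈q) =
    contradiction z∈q (pos y∈S (x∈p∧x≢y⇒x∈p-y z∈S (≢-sym y≢z)) q (SplitAt-IsGeodesic s γ))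

  geodesic-length≤ : ∀ {x v} {S : Subset n} {p : Vec (Fin n) (suc k)} →
                     IsPositionSet G x S → IsGeodesic G x v p → k ≤ n ∸ ∣ S ∣
  geodesic-length≤ {S = S} pos γ@(π , _) =
    ≤-trans (allButOne⇒length≤∣∣ (∁ S) (IsPath.distinct π) (geodesic-avoids pos γ))
            (≤-reflexive (∣∁p∣≡n∸∣p∣ S))

module _ (G : Graph n) (conn : Connected G) where

  positionNumber≤n : ∀ x → positionNumber G conn x ≤ n
  positionNumber≤n x with _ , (S , _ , refl) , _ ← largestPositionSet G conn x = ∣p∣≤n S

  -- The bound is uniform in `v`, so it passes to the maximum `ecc` without choosing a farthest
  -- vertex.
  dist≤n∸positionNumber : ∀ x v → dist G conn x v ≤ n ∸ positionNumber G conn x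
  dist≤n∸positionNumber x v
    with _ , (S , pos , refl) , _ ← largestPositionSet G conn x
       | _ , (p , π) , least ← shortest G conn x v =
    geodesic-length≤ G pos (π , λ q ρ → least (q , ρ))

lemma2p10 : (n : ℕ) .{{_ : NonZero n}} (G : Graph n) (conn : Connected G) →
    ((x : Fin n) → positionNumber G conn x ≤ n ∸ ecc G conn x)
    × (vp G conn ≤ n ∸ rad G conn)
    × (vp⁻ G conn ≤ n ∸ diam G conn)
lemma2p10 n G conn = p≤ , vp≤ , vp⁻≤
  where
  p : Fin n → ℕ
  p = positionNumber G conn

  ecc≤ : ∀ x → ecc G conn x ≤ n ∸ p x
  ecc≤ x = maximum≤ _ (dist≤n∸positionNumber G conn x)

  p≤ : ∀ x → p x ≤ n ∸ ecc G conn x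
  p≤ x = m≤n∸o⇒o≤n∸m (positionNumber≤n G conn x) (ecc≤ x)

  vp≤ : vp G conn ≤ n ∸ rad G conn
  vp≤ = maximum≤ p λ x → ≤-trans (p≤ x) (∸-monoʳ-≤ n (minimum≤ (ecc G conn) x))

  vp⁻≤ : vp⁻ G conn ≤ n ∸ diam G conn
  -- It suffices to bound `diam` by `n ∸ vp⁻`, and this can be checked at each `x` separately:
  -- `ecc x ≤ n ∸ p x ≤ n ∸ vp⁻`. No vertex of maximum eccentricity has to be found.
  vp⁻≤ = m≤n∸o⇒o≤n∸m (minimum≤⁺ p (positionNumber≤n G conn))
    (maximum≤ (ecc G conn) λ x → ≤-trans (ecc≤ x) (∸-monoʳ-≤ n (minimum≤ p x)))
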